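{- Let $\alpha=\alpha_1\alpha_2\ldots$ be an infinite binary periodic word containing at least one $1$. Then the class $\mathcal{G}_\alpha$ is a minimal hereditary class of graphs of unbounded clique-width, and it is also a minimal hereditary class of graphs of unbounded linear clique-width.
   Context: Graphs are undirected, without loops or multiple edges, and (apart from the infinite graphs $\mathcal{P}$, $\mathcal{P}^\alpha$ below) finite and nonempty. A class of graphs (closed under isomorphism) is hereditary if it is closed under taking induced subgraphs. The clique-width $\mathrm{cwd}(G)$ of a graph $G$ is the minimum number of labels needed to construct $G$ by an expression using the following operations: creation of a new vertex $v$ with label $i$; disjoint union $\oplus$ of two labelled graphs; $\eta_{i,j}$ ($i\neq j$), adding all edges between vertices labelled $i$ and vertices labelled $j$; $\rho_{i\to j}$, renaming label $i$ to label $j$. The linear clique-width $\mathrm{lcwd}(G)$ is the minimum number of labels in such an expression whose associated tree is a caterpillar, i.e. in which every $\oplus$-operation has at least one operand that is a single newly created vertex. A class has unbounded clique-width (respectively, linear clique-width) if there is no constant bounding this parameter on all graphs in the class. A hereditary class $X$ is a minimal hereditary class of unbounded clique-width (respectively, linear clique-width) if it has unbounded clique-width (respectively, linear clique-width) and every hereditary class properly contained in $X$ has bounded clique-width (respectively, linear clique-width). An infinite word $\alpha=\alpha_1\alpha_2\ldots$ is periodic if there is a positive integer $p$ with $\alpha_i=\alpha_{i+p}$ for all $i\geq 1$. Let $\mathbb{N}=\{1,2,\ldots\}$. The graph $\mathcal{P}$ has vertex set $\{v_{i,j}: i,j\in\mathbb{N}\}$ and edge set $\{\{v_{i,j},v_{i,j+1}\}: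 i,j\in\mathbb{N}\}$. Its $j$th column is $V_j=\{v_{i,j}: i\in\mathbb{N}\}$. For an infinite binary word $\alpha$, the graph $\mathcal{P}^\alpha$ is obtained from $\mathcal{P}$ by complementing the edges between $V_j$ and $V_{j+1}$ for exactly those $j$ with $\alpha_j=1$; that is, the only edges are between consecutive columns, and $v_{i,j}$ is adjacent to $v_{k,j+1}$ iff ($\alpha_j=0$ and $i=k$) or ($\alpha_j=1$ and $i\neq k$). The class $\mathcal{G}_\alpha$ consists of all finite induced subgraphs of $\mathcal{P}^\alpha$ (up to isomorphism). -}

module Defs where

open import Data.Bool using (Bool; true; false; _∧_; _∨_; _xor_; if_then_else_)
open import Data.Bool.Properties using (∨-comm)
open import Data.Empty using (⊥; ⊥-elim)
open import Data.Fin using (Fin)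
import Data.Fin as Fin
open import Data.Nat using (ℕ; suc; _+_; _≤_; _<_; _≟_)
open import Data.Nat.Properties using (1+n≢n)
open import Data.Product using (_×_; _,_; ∃-syntax; Σ-syntax)
open import Data.Sum using (_⊎_; inj₁; inj₂)
open import Data.Unit using (⊤)
open import Function using (_∘_)
open import Function.Bundles using (_↣_; _↔_; module Injection; module Inverse)
open import Level using (Level; 0ℓ)
import Level
open import Relation.Binary.PropositionalEquality
open import Relation.Nullary using (¬_; does; yes; no)
open import Relation.Nullary.Decidable using (dec-false)
open import Relation.Unary using (Pred; _∈_; _∉_; _⊆_)

infix 4 _≅_ _≤ᵢ_

record Graph (V : Set) : Set where
  field
    adj     : V → V → Bool
    sym-adj : ∀ u v → adj u v ≡ adj v u
    irrefl  : ∀ v → adj v v ≡ false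

open Graph public

record _≅_ {V W : Set} (G : Graph V) (H : Graph W) : Set where
  field
    bijection : V ↔ W
    preserves : ∀ u v → adj G u v ≡ adj H (Inverse.to bijection u) (Inverse.to bijection v)

-- G ≤ᵢ H: G is isomorphic to an induced subgraph of H.
record _≤ᵢ_ {V W : Set} (G : Graph V) (H : Graph W) : Set where
  field
    injection : V ↣ W
    preserves : ∀ u v → adj G u v ≡ adj H (Injection.to injection u) (Injection.to injection v)

-- Finite graphs are nonempty, hence the successor.
record FinGraph : Set where
  constructor finGraph
  field
    {order-1} : ℕ
    graph     : Graph (Fin (suc order-1))

open FinGraph public

GraphClass : (ℓ : Level) → Set (Level.suc ℓ)
GraphClass ℓ = Pred FinGraph ℓ

-- Closure under isomorphism is included, since isomorphic graphs are related by _≤ᵢ_.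
Hereditary : ∀ {ℓ} → GraphClass ℓ → Set ℓ
Hereditary X = ∀ {G H} → G ∈ X → graph H ≤ᵢ graph G → H ∈ X

data Expr (k : ℕ) : Set where
  vertex : (i : Fin k) → Expr k
  _⊕_    : (e f : Expr k) → Expr k
  η      : (i j : Fin k) → i ≢ j → Expr k → Expr k
  ρ      : (i j : Fin k) → Expr k → Expr k

Vertex : ∀ {k} → Expr k → Set
Vertex (vertex i)  = ⊤
Vertex (e ⊕ f)     = Vertex e ⊎ Vertex f
Vertex (η i j _ e) = Vertex e
Vertex (ρ i j e)   = Vertex e

label : ∀ {k} (e : Expr k) → Vertex e → Fin k
label (vertex i)  _        = i
label (e ⊕ f)     (inj₁ u) = label e u
label (e ⊕ f)     (inj₂ v) = label f v
label (η i j _ e) v        = label e v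
label (ρ i j e)   v        = if does (label e v Fin.≟ i) then j else label e v

hasLabels : ∀ {k} → Fin k → Fin k → Fin k → Fin k → Bool
hasLabels i j a b = does (a Fin.≟ i) ∧ does (b Fin.≟ j)

adjacent : ∀ {k} (e : Expr k) → Vertex e → Vertex e → Bool
adjacent (vertex i)  _        _        = false
adjacent (e ⊕ f)     (inj₁ u) (inj₁ v) = adjacent e u v
adjacent (e ⊕ f)     (inj₁ u) (inj₂ v) = false
adjacent (e ⊕ f)     (inj₂ u) (inj₁ v) = false
adjacent (e ⊕ f)     (inj₂ u) (inj₂ v) = adjacent f u v
adjacent (η i j _ e) u        v        =
  adjacent e u v ∨ (hasLabels i j (label e u) (label e v) ∨ hasLabels i j (label e v) (label e u))
adjacent (ρ i j e)   u        v        = adjacent e u v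

hasLabels-irrefl : ∀ {k} {i j : Fin k} → i ≢ j → ∀ a → hasLabels i j a a ≡ false
hasLabels-irrefl {i = i} {j} i≢j a with a Fin.≟ i | a Fin.≟ j
... | yes p | yes q = ⊥-elim (i≢j (trans (sym p) q))
... | yes _ | no  _ = refl
... | no  _ | _     = refl

adjacent-sym : ∀ {k} (e : Expr k) u v → adjacent e u v ≡ adjacent e v u
adjacent-sym (vertex i)  _        _        = refl
adjacent-sym (e ⊕ f)     (inj₁ u) (inj₁ v) = adjacent-sym e u v
adjacent-sym (e ⊕ f)     (inj₁ u) (inj₂ v) = refl
adjacent-sym (e ⊕ f)     (inj₂ u) (inj₁ v) = refl
adjacent-sym (e ⊕ f)     (inj₂ u) (inj₂ v) = adjacent-sym f u v
adjacent-sym (η i j _ e) u        v        =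
  cong₂ _∨_ (adjacent-sym e u v) (∨-comm (hasLabels i j (label e u) (label e v)) _)
adjacent-sym (ρ i j e)   u        v        = adjacent-sym e u v

adjacent-irrefl : ∀ {k} (e : Expr k) v → adjacent e v v ≡ false
adjacent-irrefl (vertex i)    _        = refl
adjacent-irrefl (e ⊕ f)       (inj₁ u) = adjacent-irrefl e u
adjacent-irrefl (e ⊕ f)       (inj₂ v) = adjacent-irrefl f v
adjacent-irrefl (η i j i≢j e) v
  rewrite adjacent-irrefl e v | hasLabels-irrefl i≢j (label e v) = refl
adjacent-irrefl (ρ i j e)     v        = adjacent-irrefl e v

⟦_⟧ : ∀ {k} (e : Expr k) → Graph (Vertex e)
⟦ e ⟧ = record { adj = adjacent e ; sym-adj = adjacent-sym e ; irrefl = adjacent-irrefl e }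

IsVertex : ∀ {k} → Expr k → Set
IsVertex (vertex _)  = ⊤
IsVertex (_ ⊕ _)     = ⊥
IsVertex (η _ _ _ _) = ⊥
IsVertex (ρ _ _ _)   = ⊥

Linear : ∀ {k} → Expr k → Set
Linear (vertex _)  = ⊤
Linear (e ⊕ f)     = (IsVertex e ⊎ IsVertex f) × Linear e × Linear f
Linear (η _ _ _ e) = Linear e
Linear (ρ _ _ e)   = Linear e

IsMinimum : Pred ℕ 0ℓ → Pred ℕ 0ℓ
IsMinimum P m = P m × (∀ {n} → P n → m ≤ n)

-- A graph parameter is given by its (functional) graph relation: p G w says
-- that the value of p at G is w.  Existence of the minimum is a classical fact,
-- so bounds are stated for every w that is the value of p at G.
Parameter : Set₁
Parameter = FinGraph → ℕ → Set

IsCliqueWidth : Parameter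
IsCliqueWidth G = IsMinimum λ k → Σ[ e ∈ Expr k ] (graph G ≅ ⟦ e ⟧)

IsLinearCliqueWidth : Parameter
IsLinearCliqueWidth G = IsMinimum λ k → Σ[ e ∈ Expr k ] (Linear e × graph G ≅ ⟦ e ⟧)

Bounded : ∀ {ℓ} → Parameter → GraphClass ℓ → Set ℓ
Bounded p X = ∃[ k ] (∀ {G} → G ∈ X → ∀ {w} → p G w → w ≤ k)

Unbounded : ∀ {ℓ} → Parameter → GraphClass ℓ → Set ℓ
Unbounded p X = ¬ Bounded p X

ProperSubclass : ∀ {ℓ ℓ′} → GraphClass ℓ → GraphClass ℓ′ → Set (ℓ Level.⊔ ℓ′)
ProperSubclass Y X = Y ⊆ X × (∃[ G ] (G ∈ X × G ∉ Y))

-- The level ℓ is that of the competing subclasses Y.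
record MinimalHereditaryUnbounded {ℓ′} (ℓ : Level) (p : Parameter) (X : GraphClass ℓ′)
       : Set (Level.suc ℓ Level.⊔ ℓ′) where
  field
    hereditary : Hereditary X
    unbounded  : Unbounded p X
    minimal    : (Y : GraphClass ℓ) → Hereditary Y → ProperSubclass Y X → Bounded p Y

-- Words, rows and columns are indexed from 0: α j is the paper's α_{j+1}, and
-- the vertex (i , j) is the paper's v_{i+1,j+1}.  The letter 1 is true.
Word : Set
Word = ℕ → Bool

Periodic : Word → Set
Periodic α = ∃[ p ] (0 < p × (∀ i → α i ≡ α (i + p)))

module _ (α : Word) where

  -- Adjacency of (i , j) and (k , suc j): the edges of 𝒫 join equal rows, and
  -- they are complemented when α j is true.
  between : (j i k : ℕ) → Bool
  between j i k = α j xor does (i ≟ k)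

  towards : ℕ × ℕ → ℕ × ℕ → Bool
  towards (i , j) (k , l) = does (l ≟ suc j) ∧ between j i k

  towards-irrefl : ∀ v → towards v v ≡ false
  towards-irrefl (i , j) =
    cong (_∧ between j i i) (dec-false (j ≟ suc j) (1+n≢n ∘ sym))

  𝒫^ : Graph (ℕ × ℕ)
  𝒫^ = record
    { adj     = λ u v → towards u v ∨ towards v u
    ; sym-adj = λ u v → ∨-comm (towards u v) (towards v u)
    ; irrefl  = λ v → cong₂ _∨_ (towards-irrefl v) (towards-irrefl v)
    }

  𝒢 : GraphClass 0ℓ
  𝒢 G = graph G ≤ᵢ 𝒫^

{-# OPTIONS --safe #-}

-- Lower bound.  In an expression for a long and much taller piece of 𝒫^ α, take a minimal
-- subexpression s = e ⊕ f containing a whole row.  No row avoids s, for otherwise the 1s of α join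
-- the row inside s to the one outside by a large induced matching, whose ends in s need distinct
-- labels.  So every row is split by s or by e; rows split at the same place need distinct labels,
-- because consecutive columns induce a perfect matching or its complement.  Hence the number of rows
-- is bounded by a function of the number of labels and of columns.
--
-- Upper bound.  Let G in 𝒢 α omit H in 𝒢 α, and cut the columns into blocks whose length is a
-- multiple of the period.  In each block fewer than a fixed number of rows are full, as otherwise H
-- embeds there.  Cut every row once per block, at a gap if there is one, and add the vertices of G
-- one by one, ordered by the number of cuts before them in their row, then by row, then by column.
-- At any time the neighbours still to come of a vertex depend only on its column, except in boundedly
-- many rows, and only boundedly many columns still have neighbours to come.

module Submission where

open import Defs
open import Algebra.Properties.CommutativeSemigroup using (x∙yz≈y∙xz)
open import Data.Bool using (Bool; true; false; _∧_; _∨_; _xor_; if_then_else_)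
import Data.Bool as Bool
open import Data.Bool.Properties using (∨-assoc; ∨-comm; ∨-identityʳ; ∨-zeroʳ)
open import Data.Empty using (⊥; ⊥-elim)
open import Data.Fin using (Fin; zero; suc; toℕ; fromℕ<; combine; remQuot; inject≤; splitAt; _↑ˡ_; _↑ʳ_)
import Data.Fin as Fin
import Data.Fin.Properties as Fin
open import Data.List using (List; []; _∷_; _++_; filter; allFin; upTo; length; lookup)
open import Data.List.Properties using (length-++)
open import Data.List.Membership.Propositional using () renaming (_∈_ to _∈ₗ_; _∉_ to _∉ₗ_)
open import Data.List.Membership.Propositional.Properties using (∈-filter⁺; ∈-filter⁻; ∈-allFin; ∈-lookup; ∈-upTo⁺; ∈-++⁺ˡ; ∈-++⁺ʳ)
import Data.List.Relation.Unary.All as All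
open import Data.List.Relation.Unary.Any using (here; there)
open import Data.List.Relation.Unary.AllPairs using (_∷_)
open import Data.List.Relation.Unary.Unique.Propositional using (Unique)
import Data.List.Relation.Unary.Unique.Propositional.Properties as Unique
open import Data.Nat using (ℕ; zero; suc; _+_; _*_; _∸_; _⊓_; _⊔_; _/_; _%_; _≤_; _<_; _≟_; _≤?_; _<?_; z≤n; s≤s)
open import Data.Nat.DivMod using (m≡m%n+[m/n]*n; m%n<n; [m+kn]%n≡m%n; m<n⇒m%n≡m; m<n⇒m/n≡0; m*n/n≡m; +-distrib-/-∣ʳ)
open import Data.Nat.Divisibility using (divides-refl)
open import Data.Nat.Induction using (<-rec)
import Data.Nat.Properties as ℕ
open import Data.Product using (Σ-syntax; ∃-syntax; _×_; _,_; proj₁; proj₂)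
import Data.Product.Properties as Product
open import Data.Sum using (_⊎_; inj₁; inj₂; [_,_]′)
open import Data.Unit using (⊤; tt)
open import Function using (_∘_; id)
open import Function.Bundles using (mk↣; mk↔ₛ′; mk⇔; module Inverse; module Injection)
open import Function.Construct.Composition using (_↣-∘_)
open import Level using (Level; 0ℓ)
open import Relation.Binary.Definitions using (tri<; tri≈; tri>)
open import Relation.Binary.PropositionalEquality
open import Relation.Nullary using (¬_; Dec; does; yes; no; contradiction; ¬?)
open import Relation.Nullary.Decidable using (dec-true; dec-false; does-⇔; decidable-stable; map′; _×-dec_; _⊎-dec_)
open import Relation.Unary using (Pred)

fin-bounded : ∀ {n} (f : Fin n → ℕ) → ∃[ b ] (∀ i → f i < b)
fin-bounded {zero}  f = 0 , λ ()
fin-bounded {suc n} f with fin-bounded (f ∘ suc)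
... | b , f<b = suc (f zero) ⊔ b , λ
  { zero    → ℕ.m≤m⊔n (suc (f zero)) b
  ; (suc i) → ℕ.≤-trans (f<b i) (ℕ.m≤n⊔m (suc (f zero)) b) }

-- Expressions realising a labelled graph on part of a vertex set

rename : ∀ {k} → Fin k → Fin k → Fin k → Fin k
rename i j a = if does (a Fin.≟ i) then j else a

-- `P`, `A` and `ℓ` live on the ambient set `V` and matter only on `P`, so they can be replaced
-- pointwise there (`realise-≗`) without touching the expression.
record Realisation {V : Set} {k} (P : Pred V 0ℓ) (A : V → V → Bool) (ℓ : V → Fin k) : Set where
  field
    expr         : Expr k
    linear       : Linear expr
    vert         : Vertex expr → V
    injective    : ∀ {x y} → vert x ≡ vert y → x ≡ y
    inside       : ∀ x → P (vert x)
    covers       : ∀ {v} → P v → ∃[ x ] vert x ≡ v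
    label-vert   : ∀ x → label expr x ≡ ℓ (vert x)
    adjacent-vert : ∀ x y → adjacent expr x y ≡ A (vert x) (vert y)

open Realisation

module _ {V : Set} {k : ℕ} where

  realise-vertex : ∀ (w : V) (i : Fin k) → Realisation (_≡ w) (λ _ _ → false) (λ _ → i)
  realise-vertex w i = record
    { expr = vertex i ; linear = tt ; vert = λ _ → w ; injective = λ _ → refl
    ; inside = λ _ → refl ; covers = λ eq → tt , sym eq
    ; label-vert = λ _ → refl ; adjacent-vert = λ _ _ → refl }

  module _ {P : Pred V 0ℓ} {A : V → V → Bool} {ℓ : V → Fin k} where

    realise-ρ : ∀ i j → Realisation P A ℓ → Realisation P A (rename i j ∘ ℓ)
    realise-ρ i j R = record
      { expr = ρ i j (expr R) ; linear = linear R ; vert = vert R ; injective = injective R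
      ; inside = inside R ; covers = covers R
      ; label-vert = λ x → cong (rename i j) (label-vert R x)
      ; adjacent-vert = adjacent-vert R }

    realise-η : ∀ {i j} → i ≢ j → Realisation P A ℓ →
      Realisation P (λ u v → A u v ∨ (hasLabels i j (ℓ u) (ℓ v) ∨ hasLabels i j (ℓ v) (ℓ u))) ℓ
    realise-η {i} {j} i≢j R = record
      { expr = η i j i≢j (expr R) ; linear = linear R ; vert = vert R ; injective = injective R
      ; inside = inside R ; covers = covers R ; label-vert = label-vert R
      ; adjacent-vert = λ x y → cong₂ _∨_ (adjacent-vert R x y)
          (cong₂ (λ a b → hasLabels i j a b ∨ hasLabels i j b a) (label-vert R x) (label-vert R y)) }

    realise-≗ : ∀ {Q : Pred V 0ℓ} {A′ ℓ′} → (∀ {v} → P v → Q v) → (∀ {v} → Q v → P v) →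
      (∀ {u v} → P u → P v → A u v ≡ A′ u v) → (∀ {v} → P v → ℓ v ≡ ℓ′ v) →
      Realisation P A ℓ → Realisation Q A′ ℓ′
    realise-≗ P⊆Q Q⊆P A≗A′ ℓ≗ℓ′ R = record
      { expr = expr R ; linear = linear R ; vert = vert R ; injective = injective R
      ; inside = P⊆Q ∘ inside R ; covers = covers R ∘ Q⊆P
      ; label-vert = λ x → trans (label-vert R x) (ℓ≗ℓ′ (inside R x))
      ; adjacent-vert = λ x y → trans (adjacent-vert R x y) (A≗A′ (inside R x) (inside R y)) }

    realise-insert : ∀ {w} → ¬ P w → ∀ {A′ : V → V → Bool} {ℓ′ : V → Fin k} →
      (∀ {u v} → P u → P v → A u v ≡ A′ u v) → (∀ {v} → P v → ℓ v ≡ ℓ′ v) →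
      (∀ v → A′ w v ≡ false) → (∀ v → A′ v w ≡ false) →
      Realisation P A ℓ → Realisation (λ v → P v ⊎ v ≡ w) A′ ℓ′
    realise-insert {w} w∉P {A′} {ℓ′} A≗A′ ℓ≗ℓ′ A′w A′ʷ R = record
      { expr = expr R ⊕ vertex (ℓ′ w) ; linear = inj₂ tt , linear R , tt
      ; vert = vert′ ; injective = injective′ ; inside = inside′ ; covers = covers′
      ; label-vert = λ { (inj₁ x) → trans (label-vert R x) (ℓ≗ℓ′ (inside R x)) ; (inj₂ _) → refl }
      ; adjacent-vert = adjacent′ }
      where
      Vert = Vertex (expr R) ⊎ ⊤

      vert′ : Vert → V
      vert′ (inj₁ x) = vert R x
      vert′ (inj₂ _) = w

      injective′ : ∀ {x y : Vert} → vert′ x ≡ vert′ y → x ≡ y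
      injective′ {inj₁ x} {inj₁ y} eq = cong inj₁ (injective R eq)
      injective′ {inj₁ x} {inj₂ _} eq = ⊥-elim (w∉P (subst P eq (inside R x)))
      injective′ {inj₂ _} {inj₁ y} eq = ⊥-elim (w∉P (subst P (sym eq) (inside R y)))
      injective′ {inj₂ _} {inj₂ _} eq = refl

      inside′ : ∀ x → P (vert′ x) ⊎ vert′ x ≡ w
      inside′ (inj₁ x) = inj₁ (inside R x)
      inside′ (inj₂ _) = inj₂ refl

      covers′ : ∀ {v} → P v ⊎ v ≡ w → ∃[ x ] vert′ x ≡ v
      covers′ (inj₁ p)    = let x , eq = covers R p in inj₁ x , eq
      covers′ (inj₂ refl) = inj₂ tt , refl

      adjacent′ : ∀ x y → adjacent (expr R ⊕ vertex (ℓ′ w)) x y ≡ A′ (vert′ x) (vert′ y)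
      adjacent′ (inj₁ x) (inj₁ y) = trans (adjacent-vert R x y) (A≗A′ (inside R x) (inside R y))
      adjacent′ (inj₁ x) (inj₂ _) = sym (A′ʷ (vert R x))
      adjacent′ (inj₂ _) (inj₁ y) = sym (A′w (vert R y))
      adjacent′ (inj₂ _) (inj₂ _) = sym (A′w w)

module _ {k m : ℕ} (src dst : Fin m → Fin k) where

  renameAll : List (Fin m) → Fin k → Fin k
  renameAll []       x = x
  renameAll (a ∷ as) x = renameAll as (rename (src a) (dst a) x)

  realise-ρs : ∀ {V P A} {ℓ : V → Fin k} as → Realisation P A ℓ → Realisation P A (renameAll as ∘ ℓ)
  realise-ρs []       R = R
  realise-ρs (a ∷ as) R = realise-ρs as (realise-ρ (src a) (dst a) R)

  module _ (src-injective : ∀ {a b} → src a ≡ src b → a ≡ b) (disjoint : ∀ {a b} → dst a ≢ src b) where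

    renameAll-dst : ∀ as b → renameAll as (dst b) ≡ dst b
    renameAll-dst []       b = refl
    renameAll-dst (a ∷ as) b rewrite dec-false (dst b Fin.≟ src a) disjoint = renameAll-dst as b

    -- No target is a source, so a label once renamed stays put, and the successive renamings act as
    -- a simultaneous one.
    renameAll-src : ∀ {as b} → b ∈ₗ as → renameAll as (src b) ≡ dst b
    renameAll-src {a ∷ as} {b} b∈ with src b Fin.≟ src a
    ... | yes eq rewrite src-injective eq = renameAll-dst as a
    renameAll-src (here refl) | no neq = contradiction refl neq
    renameAll-src (there b∈)  | no neq = renameAll-src b∈

-- Linear expressions from a vertex ordering

module Joining {k m : ℕ} (fresh : Fin k) (pal : Fin m → Fin k) (fresh≢pal : ∀ a → fresh ≢ pal a) where

  joined : List (Fin m) → Fin k → Fin k → Bool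
  joined []       a b = false
  joined (x ∷ xs) a b = (hasLabels fresh (pal x) a b ∨ hasLabels fresh (pal x) b a) ∨ joined xs a b

  realise-ηs : ∀ {V P A} {ℓ : V → Fin k} xs → Realisation P A ℓ →
    Realisation P (λ u v → A u v ∨ joined xs (ℓ u) (ℓ v)) ℓ
  realise-ηs []       R = realise-≗ id id (λ _ _ → sym (∨-identityʳ _)) (λ _ → refl) R
  realise-ηs {A = A} (x ∷ xs) R = realise-≗ id id (λ {u} {v} _ _ → ∨-assoc (A u v) _ _) (λ _ → refl)
    (realise-ηs xs (realise-η (fresh≢pal x) R))

  joined-sym : ∀ xs a b → joined xs a b ≡ joined xs b a
  joined-sym []       a b = refl
  joined-sym (x ∷ xs) a b = cong₂ _∨_ (∨-comm (hasLabels fresh (pal x) a b) _) (joined-sym xs a b)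

  joined-pal : ∀ xs a b → joined xs (pal a) (pal b) ≡ false
  joined-pal []       a b = refl
  joined-pal (x ∷ xs) a b
    rewrite dec-false (pal a Fin.≟ fresh) (fresh≢pal a ∘ sym)
          | dec-false (pal b Fin.≟ fresh) (fresh≢pal b ∘ sym) = joined-pal xs a b

  joined-fresh : ∀ xs → joined xs fresh fresh ≡ false
  joined-fresh []       = refl
  joined-fresh (x ∷ xs)
    rewrite dec-false (fresh Fin.≟ pal x) (fresh≢pal x) | dec-true (fresh Fin.≟ fresh) refl = joined-fresh xs

  joined⁺ : ∀ {xs a} → a ∈ₗ xs → joined xs fresh (pal a) ≡ true
  joined⁺ {x ∷ xs} (here refl)
    rewrite dec-true (fresh Fin.≟ fresh) refl | dec-true (pal x Fin.≟ pal x) refl = refl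
  joined⁺ {x ∷ xs} (there a∈) rewrite joined⁺ a∈ = ∨-zeroʳ _

  joined⁻ : (∀ {a b} → pal a ≡ pal b → a ≡ b) → ∀ xs {a} → joined xs fresh (pal a) ≡ true → a ∈ₗ xs
  joined⁻ pal-injective (x ∷ xs) {a} eq with pal a Fin.≟ pal x
  ... | yes p = here (pal-injective p)
  ... | no ¬p rewrite dec-true (fresh Fin.≟ fresh) refl
                    | dec-false (pal a Fin.≟ fresh) (fresh≢pal a ∘ sym) = there (joined⁻ pal-injective xs eq)

true⇔true : ∀ {x y : Bool} → (x ≡ true → y ≡ true) → (y ≡ true → x ≡ true) → x ≡ y
true⇔true {false} {false} f g = refl
true⇔true {false} {true}  f g = g refl
true⇔true {true}          f g = sym (f refl)

-- Vertices are added in the order of `key`. Placed vertices with the same `code w` have the same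
-- neighbours after `w`, so they may share a label. The `suc c + c` labels are one for the newest
-- vertex, `c` lasting ones and `c` temporary ones.
module LinearConstruction {n : ℕ} (G : Graph (Fin (suc n))) (key : Fin (suc n) → ℕ)
  (key-injective : ∀ {u v} → key u ≡ key v → u ≡ v) {c : ℕ}
  (code : Fin (suc n) → Fin (suc n) → Fin c)
  (code-twins : ∀ w {u v x} → key u ≤ key w → key v ≤ key w → key w < key x →
    code w u ≡ code w v → adj G u x ≡ adj G v x) where

  private
    V = Fin (suc n)

    pal tmp : Fin c → Fin (suc c + c)
    pal a = suc a ↑ˡ c
    tmp a = suc c ↑ʳ a

    fresh : Fin (suc c + c)
    fresh = zero

    -- `src₁ zero` is `fresh` and `src₁ (suc a)` is `pal a`, so one pass handles the newest vertex
    -- and the old colours together.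
    src₁ : Fin (suc c) → Fin (suc c + c)
    src₁ a = a ↑ˡ c

    tmp≢src₁ : ∀ a b → tmp a ≢ src₁ b
    tmp≢src₁ a b eq with trans (sym (Fin.splitAt-↑ʳ (suc c) c a)) (trans (cong (splitAt (suc c)) eq) (Fin.splitAt-↑ˡ (suc c) b c))
    ... | ()

    pal-injective : ∀ {a b} → pal a ≡ pal b → a ≡ b
    pal-injective = Fin.suc-injective ∘ Fin.↑ˡ-injective c _ _

    fresh≢pal : ∀ a → fresh ≢ pal a
    fresh≢pal a ()

    open Joining fresh pal fresh≢pal

    -- Two passes, since renaming the labels one by one within a single palette would merge
    -- old labels with new ones.
    relabel : (Fin (suc c) → Fin c) → Fin (suc c + c) → Fin (suc c + c)
    relabel f = renameAll tmp pal (allFin c) ∘ renameAll src₁ (tmp ∘ f) (allFin (suc c))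

    realise-relabel : ∀ {V P A} {ℓ : V → Fin (suc c + c)} f → Realisation P A ℓ → Realisation P A (relabel f ∘ ℓ)
    realise-relabel f R = realise-ρs tmp pal (allFin c) (realise-ρs src₁ (tmp ∘ f) (allFin (suc c)) R)

    relabel-≡ : ∀ f a → relabel f (src₁ a) ≡ pal (f a)
    relabel-≡ f a = trans
      (cong (renameAll tmp pal (allFin c))
        (renameAll-src src₁ (tmp ∘ f) (Fin.↑ˡ-injective c _ _) (tmp≢src₁ _ _) (∈-allFin a)))
      (renameAll-src tmp pal (Fin.↑ʳ-injective (suc c) _ _) (tmp≢src₁ _ _ ∘ sym) (∈-allFin (f a)))

    record Built (m : ℕ) : Set where
      field
        colour      : V → Fin c
        realisation : Realisation (λ v → key v < m) (adj G) (pal ∘ colour)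
        twins       : ∀ {u v x} → key u < m → key v < m → m ≤ key x →
                      colour u ≡ colour v → adj G u x ≡ adj G v x

    first : ∀ w → (∀ v → key w ≤ key v) → Built (suc (key w))
    first w least = record
      { colour = λ _ → code w w
      ; realisation = realise-≗ (λ { refl → ℕ.≤-refl }) only (λ { refl refl → sym (irrefl G w) })
          (λ _ → refl) (realise-vertex w (pal (code w w)))
      ; twins = λ u< v< _ _ → cong (λ t → adj G t _) (trans (only u<) (sym (only v<))) }
      where
      only : ∀ {v} → key v < suc (key w) → v ≡ w
      only (s≤s v≤w) = key-injective (ℕ.≤-antisym v≤w (least _))

    extend : ∀ w → Built (key w) → Built (suc (key w))
    extend w B = record
      { colour = colour′
      ; realisation = realise-≗ fwd bwd adjacency (λ {v} _ → relabel-≡ f (slot v))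
          (realise-relabel f (realise-ηs nbrs inserted))
      ; twins = λ u< v< <x eq →
          trans (rep-twin (bwd u<) <x) (trans
            (code-twins w (rep-≤ (bwd u<)) (rep-≤ (bwd v<)) <x
              (trans (sym (f-label (bwd u<))) (trans eq (f-label (bwd v<)))))
            (sym (rep-twin (bwd v<) <x))) }
      where
      open Built B

      P : V → Set
      P v = key v < key w

      P⁺ : V → Set
      P⁺ v = P v ⊎ v ≡ w

      fwd : ∀ {v} → P⁺ v → key v < suc (key w)
      fwd (inj₁ v<w)  = ℕ.m≤n⇒m≤1+n v<w
      fwd (inj₂ refl) = ℕ.≤-refl

      bwd : ∀ {v} → key v < suc (key w) → P⁺ v
      bwd (s≤s v≤w) with ℕ.m≤n⇒m<n∨m≡n v≤w
      ... | inj₁ v<w = inj₁ v<w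
      ... | inj₂ v≡w = inj₂ (key-injective v≡w)

      P⇒≢w : ∀ {v} → P v → v ≢ w
      P⇒≢w v<v refl = ℕ.<-irrefl refl v<v

      slot : V → Fin (suc c)
      slot v = if does (v Fin.≟ w) then zero else suc (colour v)

      slot-P : ∀ {v} → P v → slot v ≡ suc (colour v)
      slot-P {v} v<w rewrite dec-false (v Fin.≟ w) (P⇒≢w v<w) = refl

      slot-w : slot w ≡ zero
      slot-w rewrite dec-true (w Fin.≟ w) refl = refl

      adj₀ : V → V → Bool
      adj₀ u v = if does (u Fin.≟ w) ∨ does (v Fin.≟ w) then false else adj G u v

      adj₀-P : ∀ {u v} → P u → P v → adj₀ u v ≡ adj G u v
      adj₀-P {u} {v} u<w v<w
        rewrite dec-false (u Fin.≟ w) (P⇒≢w u<w) | dec-false (v Fin.≟ w) (P⇒≢w v<w) = refl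

      adj₀-wˡ : ∀ v → adj₀ w v ≡ false
      adj₀-wˡ v rewrite dec-true (w Fin.≟ w) refl = refl

      adj₀-wʳ : ∀ v → adj₀ v w ≡ false
      adj₀-wʳ v rewrite dec-true (w Fin.≟ w) refl | ∨-comm (does (v Fin.≟ w)) true = refl

      inserted : Realisation P⁺ adj₀ (src₁ ∘ slot)
      inserted = realise-insert (ℕ.<-irrefl refl) (λ p q → sym (adj₀-P p q))
        (λ p → cong src₁ (sym (slot-P p))) adj₀-wˡ adj₀-wʳ realisation

      Nbr : Fin c → V → Set
      Nbr a v = P v × colour v ≡ a × adj G w v ≡ true

      nbr? : ∀ a → Dec (∃[ v ] Nbr a v)
      nbr? a = Fin.any? λ v → (key v <? key w) ×-dec (colour v Fin.≟ a) ×-dec (adj G w v Bool.≟ true)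

      nbrs : List (Fin c)
      nbrs = filter nbr? (allFin c)

      -- By `twins` a colour class lies wholly inside or wholly outside the neighbourhood of `w`, so
      -- joining whole classes adds no wrong edge.
      joined-w : ∀ {v} → P v → joined nbrs fresh (pal (colour v)) ≡ adj G w v
      joined-w {v} v<w = true⇔true
        (λ eq → let u , u<w , same , wu = proj₂ (∈-filter⁻ nbr? {xs = allFin c}
                      (joined⁻ pal-injective nbrs eq))
                in trans (sym-adj G w v) (trans (sym (twins u<w v<w ℕ.≤-refl same)) (trans (sym-adj G u w) wu)))
        (λ wv → joined⁺
                  (∈-filter⁺ nbr? (∈-allFin _) (v , v<w , refl , wv)))

      adjacency : ∀ {u v} → P⁺ u → P⁺ v →
        adj₀ u v ∨ joined nbrs (src₁ (slot u)) (src₁ (slot v)) ≡ adj G u v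
      adjacency {u} {v} (inj₁ p) (inj₁ q)
        rewrite adj₀-P p q | slot-P p | slot-P q
              | joined-pal nbrs (colour u) (colour v) = ∨-identityʳ _
      adjacency {u} {v} (inj₁ p) (inj₂ refl)
        rewrite adj₀-wʳ u | slot-P p | slot-w
              | joined-sym nbrs (pal (colour u)) fresh
        = trans (joined-w p) (sym-adj G w u)
      adjacency {u} {v} (inj₂ refl) (inj₁ q)
        rewrite adj₀-wˡ v | slot-P q | slot-w = joined-w q
      adjacency (inj₂ refl) (inj₂ refl)
        rewrite adj₀-wˡ w | slot-w | irrefl G w = joined-fresh nbrs

      member? : ∀ a → Dec (∃[ v ] (P v × colour v ≡ a))
      member? a = Fin.any? λ v → (key v <? key w) ×-dec (colour v Fin.≟ a)

      f : Fin (suc c) → Fin c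
      f zero = code w w
      f (suc a) with member? a
      ... | yes (v , _) = code w v
      ... | no  _       = code w w

      colour′ : V → Fin c
      colour′ v = f (slot v)

      -- A renaming sees only colours, so the new colour of an old vertex `v` is the code of some
      -- placed `r` of the same old colour; `twins` lets `r` stand for `v` towards later vertices.
      representative : ∀ {v} → P⁺ v → ∃[ r ] (key r ≤ key w × f (slot v) ≡ code w r ×
        (∀ {x} → key w < key x → adj G v x ≡ adj G r x))
      representative (inj₂ refl) = w , ℕ.≤-refl , cong f slot-w , λ _ → refl
      representative {v} (inj₁ p) rewrite slot-P p with member? (colour v)
      ... | yes (u , u<w , same) = u , ℕ.<⇒≤ u<w , refl , λ w<x → sym (twins u<w p (ℕ.<⇒≤ w<x) same)
      ... | no none = contradiction (v , p , refl) none

      rep-≤ : ∀ {v} (p : P⁺ v) → key (proj₁ (representative p)) ≤ key w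
      rep-≤ p = proj₁ (proj₂ (representative p))

      f-label : ∀ {v} (p : P⁺ v) → colour′ v ≡ code w (proj₁ (representative p))
      f-label p = proj₁ (proj₂ (proj₂ (representative p)))

      rep-twin : ∀ {v x} (p : P⁺ v) → key w < key x → adj G v x ≡ adj G (proj₁ (representative p)) x
      rep-twin p = proj₂ (proj₂ (proj₂ (representative p)))

    -- Every expression has a vertex, so the empty set has no realisation; the first alternative
    -- covers it, and `first` starts the construction at the least key.
    build : ∀ m → (∀ v → m ≤ key v) ⊎ Built m
    build zero = inj₁ λ _ → z≤n
    build (suc m) with build m | Fin.any? (λ v → key v ℕ.≟ m)
    ... | inj₁ least | yes (w , refl) = inj₂ (first w least)
    ... | inj₂ B     | yes (w , refl) = inj₂ (extend w B)
    ... | inj₁ least | no none = inj₁ λ v → ℕ.≤∧≢⇒< (least v) λ eq → none (v , sym eq)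
    ... | inj₂ B     | no none = inj₂ record
      { colour = Built.colour B
      ; realisation = realise-≗ ℕ.m≤n⇒m≤1+n shrink (λ _ _ → refl) (λ _ → refl) (Built.realisation B)
      ; twins = λ u< v< m<x → Built.twins B (shrink u<) (shrink v<) (ℕ.<⇒≤ m<x) }
      where
      shrink : ∀ {v} → key v < suc m → key v < m
      shrink {v} (s≤s v≤m) = ℕ.≤∧≢⇒< v≤m λ eq → none (v , eq)

  linear-expression : Σ[ e ∈ Expr (suc c + c) ] (Linear e × G ≅ ⟦ e ⟧)
  linear-expression with fin-bounded key
  ... | b , key<b with build b
  ... | inj₁ least = contradiction (least zero) (ℕ.<⇒≱ (key<b zero))
  ... | inj₂ B = expr R , linear R , record
    { bijection = mk↔ₛ′ to (vert R) (λ x → injective R (vert-to (vert R x))) vert-to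
    ; preserves = λ u v → sym (trans (adjacent-vert R (to u) (to v)) (cong₂ (adj G) (vert-to u) (vert-to v))) }
    where
    R = Built.realisation B

    to : V → Vertex (expr R)
    to v = proj₁ (covers R (key<b v))

    vert-to : ∀ v → vert R (to v) ≡ v
    vert-to v = proj₂ (covers R (key<b v))

-- The minimum exists only up to double negation, which is enough for refuting a bound.
¬¬-minimum : ∀ {P : Pred ℕ 0ℓ} {n} → P n → ¬ ¬ (∃[ m ] IsMinimum P m)
¬¬-minimum {P} {n} Pn none = <-rec (λ n → ¬ P n)
  (λ n below Pn → none (n , Pn , λ {m} Pm → ℕ.≮⇒≥ λ m<n → below m<n Pm)) n Pn

induced : ∀ {V W : Set} → Graph W → (V → W) → Graph V
induced G f = record
  { adj = λ u v → adj G (f u) (f v) ; sym-adj = λ u v → sym-adj G (f u) (f v) ; irrefl = λ v → irrefl G (f v) }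

does-≟-sym : ∀ m n → does (m ≟ n) ≡ does (n ≟ m)
does-≟-sym m n = does-⇔ (mk⇔ sym sym) (m ≟ n) (n ≟ m)

-- Adjacency between columns, and finite searches

Near : ℕ → ℕ → Set
Near a b = b ≡ suc a ⊎ a ≡ suc b

near? : ∀ a b → Dec (Near a b)
near? a b = (b ≟ suc a) ⊎-dec (a ≟ suc b)

module _ (α : Word) where

  adj-near : ∀ {a b} → Near a b → ∃[ β ] (∀ r s → adj (𝒫^ α) (r , a) (s , b) ≡ β xor does (r ≟ s))
  adj-near {a} (inj₁ refl) = α a , λ r s → adjacency r s
    where
    adjacency : ∀ r s → adj (𝒫^ α) (r , a) (s , suc a) ≡ α a xor does (r ≟ s)
    adjacency r s rewrite dec-true (a ≟ a) refl | dec-false (a ≟ suc (suc a)) (λ ()) = ∨-identityʳ _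
  adj-near {b = b} (inj₂ refl) = α b , λ r s → adjacency r s
    where
    adjacency : ∀ r s → adj (𝒫^ α) (r , suc b) (s , b) ≡ α b xor does (r ≟ s)
    adjacency r s rewrite dec-true (b ≟ b) refl | dec-false (b ≟ suc (suc b)) (λ ()) =
      cong (α b xor_) (does-≟-sym s r)

  adj-far : ∀ {a b} → ¬ Near a b → ∀ r s → adj (𝒫^ α) (r , a) (s , b) ≡ false
  adj-far {a} {b} far r s
    rewrite dec-false (b ≟ suc a) (far ∘ inj₁) | dec-false (a ≟ suc b) (far ∘ inj₂) = refl

  periodic-* : ∀ {p} → (∀ i → α i ≡ α (i + p)) → ∀ l i → α (i + l * p) ≡ α i
  periodic-* per zero    i = cong α (ℕ.+-identityʳ i)
  periodic-* {p} per (suc l) i =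
    trans (cong α (sym (ℕ.+-assoc i p (l * p)))) (trans (periodic-* per l (i + p)) (sym (per i)))

xor-≢ : ∀ β → β xor true ≢ β xor false
xor-≢ false ()
xor-≢ true  ()

-- A discrete intermediate value principle: the first change of truth value supplies the pair,
-- ordered so that `Q` holds at `a`.
change : ∀ {Q : Pred ℕ 0ℓ} → (∀ j → Dec (Q j)) → ∀ m →
  (∀ {j} → j < suc m → Q j) ⊎ (∀ {j} → j < suc m → ¬ Q j) ⊎
  (∃[ a ] ∃[ b ] (a < suc m × b < suc m × Near a b × Q a × ¬ Q b))
change Q? zero with Q? 0
... | yes q = inj₁ λ { (s≤s z≤n) → q }
... | no ¬q = inj₂ (inj₁ λ { (s≤s z≤n) → ¬q })
change {Q} Q? (suc m) with change Q? m | Q? (suc m)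
... | inj₂ (inj₂ (a , b , a< , b< , rest)) | _ =
  inj₂ (inj₂ (a , b , ℕ.m≤n⇒m≤1+n a< , ℕ.m≤n⇒m≤1+n b< , rest))
... | inj₁ all | no ¬q = inj₂ (inj₂ (m , suc m , ℕ.n≤1+n _ , ℕ.≤-refl , inj₁ refl , all ℕ.≤-refl , ¬q))
... | inj₂ (inj₁ none) | yes q =
  inj₂ (inj₂ (suc m , m , ℕ.≤-refl , ℕ.n≤1+n _ , inj₂ refl , q , none ℕ.≤-refl))
... | inj₁ all | yes q = inj₁ λ j<2+m → cases j<2+m
  where
  cases : ∀ {j} → j < suc (suc m) → Q j
  cases (s≤s j≤) with ℕ.m≤n⇒m<n∨m≡n j≤
  ... | inj₁ j< = all j<
  ... | inj₂ refl = q
... | inj₂ (inj₁ none) | no ¬q = inj₂ (inj₁ λ j<2+m → cases j<2+m)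
  where
  cases : ∀ {j} → j < suc (suc m) → ¬ Q j
  cases (s≤s j≤) with ℕ.m≤n⇒m<n∨m≡n j≤
  ... | inj₁ j< = none j<
  ... | inj₂ refl = ¬q

vertex-any? : ∀ {k} (e : Expr k) {P : Vertex e → Set} → (∀ x → Dec (P x)) → Dec (∃[ x ] P x)
vertex-any? (vertex i) P? = map′ (tt ,_) proj₂ (P? tt)
vertex-any? (e ⊕ f) {P} P? = map′ to from
  (vertex-any? e (P? ∘ inj₁) ⊎-dec vertex-any? f (P? ∘ inj₂))
  where
  to : (∃[ x ] P (inj₁ x)) ⊎ (∃[ y ] P (inj₂ y)) → ∃[ x ] P x
  to (inj₁ (x , p)) = inj₁ x , p
  to (inj₂ (y , p)) = inj₂ y , p
  from : ∃[ x ] P x → (∃[ x ] P (inj₁ x)) ⊎ (∃[ y ] P (inj₂ y))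
  from (inj₁ x , p) = inj₁ (x , p)
  from (inj₂ y , p) = inj₂ (y , p)
vertex-any? (η i j _ e) P? = vertex-any? e P?
vertex-any? (ρ i j e) P? = vertex-any? e P?

-- Lower bound: few labels cannot build a large grid

module Grid (α : Word) (N′ M′ : ℕ) where

  N M : ℕ
  N = suc N′
  M = suc M′

  position : Fin (N * M) → ℕ × ℕ
  position v = toℕ (proj₁ (remQuot {N} M v)) , toℕ (proj₂ (remQuot {N} M v))

  position-combine : ∀ i j → position (combine i j) ≡ (toℕ i , toℕ j)
  position-combine i j = cong (λ (a , b) → toℕ a , toℕ b) (Fin.remQuot-combine {N} {M} i j)

  position-injective : ∀ {u v} → position u ≡ position v → u ≡ v
  position-injective {u} {v} eq = trans (sym (Fin.combine-remQuot {N} M u)) (trans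
    (cong₂ combine (Fin.toℕ-injective (Product.,-injectiveˡ eq)) (Fin.toℕ-injective (Product.,-injectiveʳ eq)))
    (Fin.combine-remQuot {N} M v))

  position-surjective : ∀ {i j} → i < N → j < M → ∃[ v ] position v ≡ (i , j)
  position-surjective i<N j<M = combine (fromℕ< i<N) (fromℕ< j<M) ,
    trans (position-combine _ _) (cong₂ _,_ (Fin.toℕ-fromℕ< i<N) (Fin.toℕ-fromℕ< j<M))

  grid : FinGraph
  grid = finGraph (induced (𝒫^ α) position)

  grid∈𝒢 : 𝒢 α grid
  grid∈𝒢 = record { injection = mk↣ position-injective ; preserves = λ _ _ → refl }

  module _ {w : ℕ} where

    In : (s : Expr w) → (Vertex s → ℕ × ℕ) → ℕ × ℕ → Set
    In s φ v = ∃[ x ] φ x ≡ v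

    in? : ∀ s φ v → Dec (In s φ v)
    in? s φ v = vertex-any? s λ x → Product.≡-dec _≟_ _≟_ (φ x) v

    -- s is a subexpression of an expression for the grid, with its vertices placed by φ;
    -- outer records the edges that the remaining operations add inside s.
    record Sub (s : Expr w) (φ : Vertex s → ℕ × ℕ) : Set where
      field
        outer   : Fin w → Fin w → Bool
        inner   : ∀ x y → adj (𝒫^ α) (φ x) (φ y) ≡ adjacent s x y ∨ outer (label s x) (label s y)
        outside : ∀ {x y i j} → label s x ≡ label s y → i < N → j < M → ¬ In s φ (i , j) →
                  adj (𝒫^ α) (φ x) (i , j) ≡ adj (𝒫^ α) (φ y) (i , j)

    open Sub

    -- The edges made by this `η` depend on labels only, so they move into `outer`.
    sub-η : ∀ {i j i≢j s φ} → Sub (η i j i≢j s) φ → Sub s φ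
    sub-η {i} {j} {s = s} S = record
      { outer   = λ a b → (hasLabels i j a b ∨ hasLabels i j b a) ∨ outer S a b
      ; inner   = λ x y → trans (inner S x y) (∨-assoc (adjacent s x y) _ _)
      ; outside = outside S }

    sub-ρ : ∀ {i j s φ} → Sub (ρ i j s) φ → Sub s φ
    sub-ρ {i} {j} S = record
      { outer   = λ a b → outer S (rename i j a) (rename i j b)
      ; inner   = inner S
      ; outside = λ eq → outside S (cong (rename i j) eq) }

    -- A grid vertex outside `e` is either outside the whole sum or in `f`. In the latter case `⊕`
    -- adds no edge, so its adjacency to vertices of `e` comes from `outer` and depends on their
    -- labels only.
    sub-⊕ˡ : ∀ {e f φ} → Sub (e ⊕ f) φ → Sub e (φ ∘ inj₁)
    sub-⊕ˡ {e} {f} {φ} S = record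
      { outer = outer S ; inner = λ x y → inner S (inj₁ x) (inj₁ y) ; outside = outside′ }
      where
      outside′ : ∀ {x y i j} → label e x ≡ label e y → i < N → j < M → ¬ In e (φ ∘ inj₁) (i , j) →
        adj (𝒫^ α) (φ (inj₁ x)) (i , j) ≡ adj (𝒫^ α) (φ (inj₁ y)) (i , j)
      outside′ {x} {y} {i} {j} eq i< j< ∉e with in? f (φ ∘ inj₂) (i , j)
      ... | no ∉f = outside S eq i< j< λ { (inj₁ z , p) → ∉e (z , p) ; (inj₂ z , p) → ∉f (z , p) }
      ... | yes (z , p) = subst (λ v → adj (𝒫^ α) (φ (inj₁ x)) v ≡ adj (𝒫^ α) (φ (inj₁ y)) v) p
        (trans (inner S (inj₁ x) (inj₂ z))
        (trans (cong (λ a → outer S a (label f z)) eq) (sym (inner S (inj₁ y) (inj₂ z)))))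

    sub-⊕ʳ : ∀ {e f φ} → Sub (e ⊕ f) φ → Sub f (φ ∘ inj₂)
    sub-⊕ʳ {e} {f} {φ} S = record
      { outer = outer S ; inner = λ x y → inner S (inj₂ x) (inj₂ y) ; outside = outside′ }
      where
      outside′ : ∀ {x y i j} → label f x ≡ label f y → i < N → j < M → ¬ In f (φ ∘ inj₂) (i , j) →
        adj (𝒫^ α) (φ (inj₂ x)) (i , j) ≡ adj (𝒫^ α) (φ (inj₂ y)) (i , j)
      outside′ {x} {y} {i} {j} eq i< j< ∉f with in? e (φ ∘ inj₁) (i , j)
      ... | no ∉e = outside S eq i< j< λ { (inj₁ z , p) → ∉e (z , p) ; (inj₂ z , p) → ∉f (z , p) }
      ... | yes (z , p) = subst (λ v → adj (𝒫^ α) (φ (inj₂ x)) v ≡ adj (𝒫^ α) (φ (inj₂ y)) v) p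
        (trans (inner S (inj₂ x) (inj₁ z))
        (trans (cong (λ a → outer S a (label e z)) eq) (sym (inner S (inj₂ y) (inj₁ z)))))

    FullRow EmptyRow : (s : Expr w) → (Vertex s → ℕ × ℕ) → ℕ → Set
    FullRow  s φ r = ∀ {j} → j < M → In s φ (r , j)
    EmptyRow s φ r = ∀ {j} → j < M → ¬ In s φ (r , j)

    record SplitRow (s : Expr w) (φ : Vertex s → ℕ × ℕ) (r : ℕ) : Set where
      constructor splitRow
      field
        {a b} : ℕ
        a<M   : a < M
        b<M   : b < M
        near  : Near a b
        x     : Vertex s
        φx    : φ x ≡ (r , a)
        out   : ¬ In s φ (r , b)

    rowStatus : ∀ s φ r → FullRow s φ r ⊎ EmptyRow s φ r ⊎ SplitRow s φ r
    rowStatus s φ r with change (λ j → in? s φ (r , j)) M′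
    ... | inj₁ full         = inj₁ full
    ... | inj₂ (inj₁ empty) = inj₂ (inj₁ empty)
    ... | inj₂ (inj₂ (a , b , a< , b< , near , (x , φx) , out)) = inj₂ (inj₂ (splitRow a< b< near x φx out))

    Code : Set
    Code = Fin (M * (M * w))

    code : ∀ {s φ r} → SplitRow s φ r → Code
    code {s} (splitRow a< b< _ x _ _) = combine (fromℕ< a<) (combine (fromℕ< b<) (label s x))

    -- The bipartite graph between two consecutive columns is a perfect matching or its complement,
    -- so a vertex (r , b) outside s tells (r , a) from every other vertex of column a.
    code-injective : ∀ {s φ r r′} → Sub s φ → r < N → (p : SplitRow s φ r) (q : SplitRow s φ r′) →
      code p ≡ code q → r ≡ r′
    code-injective {s} {φ} {r} {r′} S r<N (splitRow {a} {b} a< b< near x φx out) (splitRow {a′} {b′} a′< b′< _ y φy _) eq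
      with r ≟ r′
    ... | yes r≡r′ = r≡r′
    ... | no r≢r′
      with Fin.combine-injective (fromℕ< a<) _ (fromℕ< a′<) _ eq
    ... | a≡ , rest
      with Fin.combine-injective (fromℕ< b<) _ (fromℕ< b′<) _ rest | Fin.fromℕ<-injective a a′ a< a′< a≡
    ... | b≡ , same | refl with adj-near α near
    ... | β , value = contradiction
      (trans (sym (trans (value r r) (cong (β xor_) (dec-true (r ≟ r) refl))))
        (trans (subst₂ (λ u v → adj (𝒫^ α) u (r , b) ≡ adj (𝒫^ α) v (r , b)) φx φy (outside S same r<N b< out))
          (trans (value r′ r) (cong (β xor_) (dec-false (r′ ≟ r) (r≢r′ ∘ sym))))))
      (xor-≢ β)

    -- There is one chosen column more than labels, for the pigeonhole. Distance 3 keeps `columns m`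
    -- off `2 + columns l`, the right neighbour of column `suc (columns l)`. The factor 2 in
    -- `many-rows` counts splits by `e ⊕ f` and by `e` separately.
    module _ (columns : Fin (suc w) → ℕ) (columns<M : ∀ l → suc (columns l) < M)
             (spread : ∀ {l m} → l Fin.< m → 3 + columns l ≤ columns m)
             (ones : ∀ l → α (columns l) ≡ true)
             (1<M : 1 < M) (many-rows : 2 * (M * (M * w)) < N) where

      -- A complemented pair of columns joins a full row to an empty one, and these edges tell
      -- the suc w chosen vertices of the full row apart.
      full-or-empty : ∀ {s φ r r′} → Sub s φ → r′ < N → FullRow s φ r → EmptyRow s φ r′ → ⊥
      full-or-empty {s} {φ} {r} {r′} S r′<N full empty
        with Fin.pigeonhole (ℕ.n<1+n w) (λ l → label s (proj₁ (full (ℕ.<-trans (ℕ.n<1+n _) (columns<M l)))))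
      ... | l , m , l<m , same = contradiction
        (trans (sym adj-l) (trans
          (subst₂ (λ u v → adj (𝒫^ α) u (r′ , suc (columns l)) ≡ adj (𝒫^ α) v (r′ , suc (columns l)))
            (proj₂ (full _)) (proj₂ (full _)) (outside S same r′<N (columns<M l) (empty (columns<M l))))
          adj-m))
        λ ()
        where
        r≢r′ : r ≢ r′
        r≢r′ refl = empty (columns<M l) (full (columns<M l))

        adj-l : adj (𝒫^ α) (r , columns l) (r′ , suc (columns l)) ≡ true
        adj-l rewrite proj₂ (adj-near α {columns l} (inj₁ refl)) r r′ | ones l | dec-false (r ≟ r′) r≢r′ = refl

        adj-m : adj (𝒫^ α) (r , columns m) (r′ , suc (columns l)) ≡ false
        adj-m = adj-far α
          (λ { (inj₁ eq) → ℕ.<⇒≢ (ℕ.≤-trans (ℕ.m≤n+m _ 2) (spread l<m)) (ℕ.suc-injective eq)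
             ; (inj₂ eq) → ℕ.<⇒≢ (spread l<m) (sym eq) }) r r′

      -- Structural induction plays the part of a minimal subexpression: at `e ⊕ f` the recursive
      -- calls exclude rows full in an operand, so every row carries a split, and there are more
      -- rows than codes.
      no-full-row : ∀ s φ {r} → Sub s φ → FullRow s φ r → ⊥
      no-full-row (vertex i) φ S full
        with trans (sym (proj₂ (full (s≤s z≤n)))) (proj₂ (full 1<M))
      ... | ()
      no-full-row (η i j _ s) φ S full = no-full-row s φ (sub-η S) full
      no-full-row (ρ i j s)   φ S full = no-full-row s φ (sub-ρ S) full
      no-full-row (e ⊕ f)     φ S full = collide (Fin.pigeonhole many-rows (λ r → tagged (rowCase r)))
        where
        Tagged : ℕ → Set
        Tagged r = SplitRow (e ⊕ f) φ r ⊎ SplitRow e (φ ∘ inj₁) r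

        -- `code-injective` compares splits by one subexpression only, hence the tag.
        tagged : ∀ {r} → Tagged r → Fin (2 * (M * (M * w)))
        tagged (inj₁ p) = combine {2} zero (code p)
        tagged (inj₂ p) = combine {2} (suc zero) (code p)

        rowCase : ∀ (r : Fin N) → Tagged (toℕ r)
        rowCase r with rowStatus (e ⊕ f) φ (toℕ r)
        ... | inj₂ (inj₂ split) = inj₁ split
        ... | inj₂ (inj₁ empty) = ⊥-elim (full-or-empty S (Fin.toℕ<n r) full empty)
        ... | inj₁ fullᵣ with rowStatus e (φ ∘ inj₁) (toℕ r)
        ... | inj₂ (inj₂ split) = inj₂ split
        ... | inj₁ fullₑ = ⊥-elim (no-full-row e (φ ∘ inj₁) (sub-⊕ˡ S) fullₑ)
        ... | inj₂ (inj₁ emptyₑ) = ⊥-elim (no-full-row f (φ ∘ inj₂) (sub-⊕ʳ S) fullf)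
          where
          fullf : FullRow f (φ ∘ inj₂) (toℕ r)
          fullf j< with fullᵣ j<
          ... | inj₁ x , p = contradiction (x , p) (emptyₑ j<)
          ... | inj₂ y , p = y , p

        tagged-injective : ∀ {r r′} → r < N → (p : Tagged r) (q : Tagged r′) → tagged p ≡ tagged q → r ≡ r′
        tagged-injective r< (inj₁ p) (inj₁ q) eq =
          code-injective S r< p q (Fin.combine-injectiveʳ {2} zero _ zero _ eq)
        tagged-injective r< (inj₂ p) (inj₂ q) eq =
          code-injective (sub-⊕ˡ S) r< p q (Fin.combine-injectiveʳ {2} (suc zero) _ (suc zero) _ eq)
        tagged-injective r< (inj₁ p) (inj₂ q) eq with Fin.combine-injectiveˡ {2} zero (code p) (suc zero) (code q) eq
        ... | ()
        tagged-injective r< (inj₂ p) (inj₁ q) eq with Fin.combine-injectiveˡ {2} (suc zero) (code p) zero (code q) eq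
        ... | ()

        collide : (∃[ r ] ∃[ r′ ] (r Fin.< r′ × tagged (rowCase r) ≡ tagged (rowCase r′))) → ⊥
        collide (r , r′ , r<r′ , same) =
          ℕ.<⇒≢ r<r′ (tagged-injective (Fin.toℕ<n r) (rowCase r) (rowCase r′) same)

      no-expression : (e : Expr w) → graph grid ≅ ⟦ e ⟧ → ⊥
      no-expression e iso = no-full-row e φ {0}
        (record
          { outer   = λ _ _ → false
          ; inner   = λ x y → trans (preserves (from x) (from y))
                        (trans (cong₂ (adjacent e) (strictlyInverseˡ x) (strictlyInverseˡ y)) (sym (∨-identityʳ _)))
          ; outside = λ _ i< j< ∉e → contradiction (covered i< j<) ∉e })
        (covered (s≤s z≤n))
        where
        open _≅_ iso
        open Inverse bijection

        φ : Vertex e → ℕ × ℕ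
        φ = position ∘ from

        covered : ∀ {i j} → i < N → j < M → In e φ (i , j)
        covered i< j< with position-surjective i< j<
        ... | v , eq = to v , trans (cong position (strictlyInverseʳ v)) eq

module _ {α : Word} {p i₀ : ℕ} (0<p : 0 < p) (periodic : ∀ i → α i ≡ α (i + p)) (one : α i₀ ≡ true) where

  private
    -- The step is a multiple of the period, so the letter stays 1, and it is at least 3 because
    -- `0 < p`, as `spread` demands.
    column : ℕ → ℕ
    column l = i₀ + l * (3 * p)

  large-grid : ∀ k → ∃[ G ] (𝒢 α G × (∀ {w} → w ≤ k → (e : Expr w) → ¬ (graph G ≅ ⟦ e ⟧)))
  large-grid k = grid , grid∈𝒢 , λ {w} w≤k → no-expression
    (column ∘ toℕ)
    (λ l → s≤s (s≤s (ℕ.+-monoʳ-≤ i₀ (ℕ.*-monoˡ-≤ (3 * p) (ℕ.≤-trans (ℕ.≤-pred (Fin.toℕ<n l)) w≤k)))))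
    spread
    (λ l → trans (cong α (cong (i₀ +_) (sym (ℕ.*-assoc (toℕ l) 3 p)))) (trans (periodic-* α periodic (toℕ l * 3) i₀) one))
    (s≤s (s≤s z≤n))
    (s≤s (ℕ.*-monoʳ-≤ 2 (ℕ.*-monoʳ-≤ M (ℕ.*-monoʳ-≤ M w≤k))))
    where
    -- Sizes are set for `k` labels and serve every `w ≤ k`. The chosen columns go up to at most
    -- `column k`, and a right neighbour must fit too: `2 + column k` columns, since `Grid` takes
    -- each size minus one.
    open Grid α (2 * ((2 + column k) * ((2 + column k) * k))) (1 + column k)

    spread : ∀ {w} {l m : Fin w} → l Fin.< m → 3 + column (toℕ l) ≤ column (toℕ m)
    spread {l = l} {m} l<m = begin
      3 + (i₀ + toℕ l * (3 * p))     ≡⟨ x∙yz≈y∙xz ℕ.+-commutativeSemigroup 3 i₀ _ ⟩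
      i₀ + (3 + toℕ l * (3 * p))     ≤⟨ ℕ.+-monoʳ-≤ i₀ (ℕ.+-monoˡ-≤ _ (ℕ.*-monoʳ-≤ 3 0<p)) ⟩
      i₀ + (3 * p + toℕ l * (3 * p)) ≤⟨ ℕ.+-monoʳ-≤ i₀ (ℕ.*-monoˡ-≤ (3 * p) l<m) ⟩
      i₀ + toℕ m * (3 * p)           ∎
      where open ℕ.≤-Reasoning

≤ᵢ-trans : ∀ {U V W} {F : Graph U} {G : Graph V} {H : Graph W} → F ≤ᵢ G → G ≤ᵢ H → F ≤ᵢ H
≤ᵢ-trans p q = record
  { injection = injection q ↣-∘ injection p
  ; preserves = λ u v → trans (preserves p u v) (preserves q _ _) }
  where open _≤ᵢ_

-- Positions in lists and lexicographic comparison

lookup-injective : ∀ {A : Set} {xs : List A} → Unique xs → ∀ {i j} → lookup xs i ≡ lookup xs j → i ≡ j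
lookup-injective (x∉ ∷ _)  {zero}  {zero}  _  = refl
lookup-injective (x∉ ∷ _)  {zero}  {suc j} eq = contradiction eq (All.lookup x∉ (∈-lookup j))
lookup-injective (x∉ ∷ _)  {suc i} {zero}  eq = contradiction (sym eq) (All.lookup x∉ (∈-lookup i))
lookup-injective (_ ∷ uxs) {suc i} {suc j} eq = cong suc (lookup-injective uxs eq)

-- Members of `xs` get distinct values and all other numbers share `length xs`, which compresses a
-- row number to boundedly many cases.
slot : List ℕ → ℕ → ℕ
slot []       a = 0
slot (x ∷ xs) a = if does (a ≟ x) then 0 else suc (slot xs a)

slot-≤ : ∀ xs a → slot xs a ≤ length xs
slot-≤ []       a = z≤n
slot-≤ (x ∷ xs) a with does (a ≟ x)
... | true  = z≤n
... | false = s≤s (slot-≤ xs a)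

slot-≡ : ∀ xs {a b} → slot xs a ≡ slot xs b → a ≡ b ⊎ (a ∉ₗ xs × b ∉ₗ xs)
slot-≡ []       _ = inj₂ ((λ ()) , (λ ()))
slot-≡ (x ∷ xs) {a} {b} eq with a ≟ x | b ≟ x
... | yes a≡x | yes b≡x = inj₁ (trans a≡x (sym b≡x))
... | yes refl | no b≢x rewrite dec-true (x ≟ x) refl | dec-false (b ≟ x) b≢x = contradiction eq λ ()
... | no a≢x | yes refl rewrite dec-true (x ≟ x) refl | dec-false (a ≟ x) a≢x = contradiction eq λ ()
... | no a≢x | no b≢x rewrite dec-false (a ≟ x) a≢x | dec-false (b ≟ x) b≢x with slot-≡ xs (ℕ.suc-injective eq)
... | inj₁ a≡b = inj₁ a≡b
... | inj₂ (a∉ , b∉) = inj₂ ((λ { (here p) → a≢x p ; (there p) → a∉ p }) , (λ { (here p) → b≢x p ; (there p) → b∉ p }))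

lex-≤ : ∀ n {a a′ b b′} → b′ < n → a * n + b ≤ a′ * n + b′ → a < a′ ⊎ (a ≡ a′ × b ≤ b′)
lex-≤ n {a} {a′} {b} {b′} b′<n le with ℕ.<-cmp a a′
... | tri< a<a′ _ _ = inj₁ a<a′
... | tri≈ _ refl _ = inj₂ (refl , ℕ.+-cancelˡ-≤ (a * n) b b′ le)
... | tri> _ _ a′<a = contradiction le (ℕ.<⇒≱ (begin-strict
  a′ * n + b′ <⟨ ℕ.+-monoʳ-< (a′ * n) b′<n ⟩
  a′ * n + n  ≡⟨ ℕ.+-comm (a′ * n) n ⟩
  suc a′ * n  ≤⟨ ℕ.*-monoˡ-≤ n a′<a ⟩
  a * n       ≤⟨ ℕ.m≤m+n (a * n) b ⟩
  a * n + b   ∎))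
  where open ℕ.≤-Reasoning

-- Upper bound: cutting rows in blocks and ordering the vertices

module Blocks (α : Word) (k′ : ℕ) (G : FinGraph) (G∈𝒢 : 𝒢 α G) where

  open _≤ᵢ_ G∈𝒢
  open Injection injection using () renaming (to to ι; injective to ι-injective)

  V : Set
  V = Fin (suc (order-1 G))

  k : ℕ
  k = suc k′

  row col : V → ℕ
  row = proj₁ ∘ ι
  col = proj₂ ∘ ι

  R C : ℕ
  R = proj₁ (fin-bounded row)
  C = proj₁ (fin-bounded col)

  row<R : ∀ v → row v < R
  row<R = proj₂ (fin-bounded row)

  col<C : ∀ v → col v < C
  col<C = proj₂ (fin-bounded col)

  Occupied : ℕ → ℕ → Set
  Occupied i j = ∃[ v ] ι v ≡ (i , j)

  occupied? : ∀ i j → Dec (Occupied i j)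
  occupied? i j = Fin.any? λ v → Product.≡-dec _≟_ _≟_ (ι v) (i , j)

  -- Block `t` consists of the `k` columns `q + t * k` with `q < k`.
  Full : ℕ → ℕ → Set
  Full t i = ∀ {q} → q < k → Occupied i (q + t * k)

  full? : ∀ t i → Dec (Full t i)
  full? t i = ℕ.allUpTo? (λ q → occupied? i (q + t * k)) k

  opaque
    fullRows : ℕ → List ℕ
    fullRows t = filter (full? t) (upTo R)

    fullRows-unique : ∀ t → Unique (fullRows t)
    fullRows-unique t = Unique.filter⁺ (full? t) (Unique.upTo⁺ R)

    full⁺ : ∀ t i → Full t i → i ∈ₗ fullRows t
    full⁺ t i full = ∈-filter⁺ (full? t)
      (∈-upTo⁺ (subst (_< R) (cong proj₁ (proj₂ occupied)) (row<R (proj₁ occupied)))) full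
      where
      occupied : Occupied i (t * k)
      occupied = full {0} (s≤s z≤n)

    full⁻ : ∀ t i → i ∈ₗ fullRows t → Full t i
    full⁻ t i i∈ = proj₂ (∈-filter⁻ (full? t) {xs = upTo R} i∈)

  gap? : ∀ t i → Dec (∃[ q ] (q < k × ¬ Occupied i (q + t * k)))
  gap? t i = ℕ.anyUpTo? (λ q → ¬? (occupied? i (q + t * k))) k

  opaque
    -- Row i is cut in block t just before the column cut t i + t * k.
    cut : ℕ → ℕ → ℕ
    cut t i with gap? t i
    ... | yes (q , _) = q
    ... | no _        = 0

    cut<k : ∀ t i → cut t i < k
    cut<k t i with gap? t i
    ... | yes (_ , q<k , _) = q<k
    ... | no _              = s≤s z≤n

    -- A cut made at a gap has an empty cell just to its right. If that cell is occupied, the row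
    -- had no gap and was cut by default at the start of the block.
    cut-occupied : ∀ {t i} → Occupied i (cut t i + t * k) → cut t i ≡ 0 × Full t i
    cut-occupied {t} {i} occ with gap? t i
    ... | yes (_ , _ , gap) = contradiction occ gap
    ... | no none = refl , λ {q} q<k → decidable-stable (occupied? i (q + t * k)) λ gap → none (q , q<k , gap)

  -- The number of cuts of row `i` up to position `q` of block `t`: one in each earlier block, and
  -- perhaps the one in this block.
  stageIn : ℕ → ℕ → ℕ → ℕ
  stageIn i t q = if does (cut t i ≤? q) then suc t else t

  opaque
    stage : ℕ → ℕ → ℕ
    stage i j = stageIn i (j / k) (j % k)

    stage-block : ∀ i t {q} → q < k → stage i (q + t * k) ≡ stageIn i t q
    stage-block i t {q} q<k = cong₂ (stageIn i)
      (trans (+-distrib-/-∣ʳ q {t * k} (divides-refl t)) (cong₂ _+_ (m<n⇒m/n≡0 q<k) (m*n/n≡m t k)))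
      (trans ([m+kn]%n≡m%n q t k) (m<n⇒m%n≡m q<k))

    stage-≥ : ∀ i j → j / k ≤ stage i j
    stage-≥ i j with does (cut (j / k) i ≤? j % k)
    ... | true  = ℕ.n≤1+n _
    ... | false = ℕ.≤-refl

    stage-≤ : ∀ i j → stage i j ≤ suc (j / k)
    stage-≤ i j with does (cut (j / k) i ≤? j % k)
    ... | true  = ℕ.≤-refl
    ... | false = ℕ.n≤1+n _

  stageIn-cut : ∀ {i t q} → cut t i ≤ q → stageIn i t q ≡ suc t
  stageIn-cut {i} {t} {q} p rewrite dec-true (cut t i ≤? q) p = refl

  stageIn-uncut : ∀ {i t q} → ¬ cut t i ≤ q → stageIn i t q ≡ t
  stageIn-uncut {i} {t} {q} p rewrite dec-false (cut t i ≤? q) p = refl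

  StageStep : ℕ → ℕ → Set
  StageStep i j = stage i j ≡ stage i (suc j) ⊎
    (∃[ t ] (Full t i × stage i j ≡ t × stage i (suc j) ≡ suc t))

  -- A cut between the two columns has an occupied cell on its right, so by `cut-occupied` it stands
  -- at the start of a block in which the row is full.
  stage-suc-in : ∀ i t q → q < k → Occupied i (suc q + t * k) → StageStep i (q + t * k)
  stage-suc-in i t q q<k occ with suc q <? k
  ... | yes 1+q<k rewrite stage-block i t q<k | stage-block i t 1+q<k with cut t i ≤? q | cut t i ≤? suc q
  ...   | yes p | _     = inj₁ (trans (stageIn-cut p) (sym (stageIn-cut (ℕ.m≤n⇒m≤1+n p))))
  ...   | no p  | no p′ = inj₁ (trans (stageIn-uncut p) (sym (stageIn-uncut p′)))
  ...   | no p  | yes p′ with ℕ.m≤n⇒m<n∨m≡n p′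
  ...     | inj₁ (s≤s c≤q) = contradiction c≤q p
  ...     | inj₂ c≡ with cut-occupied {t} {i} (subst (λ c → Occupied i (c + t * k)) (sym c≡) occ)
  ...       | c≡0 , _ = contradiction (trans (sym c≡) c≡0) λ ()
  -- Here `q` is the last position of block `t`, whose cut is already passed, and the next column
  -- opens block `suc t`.
  stage-suc-in i t q q<k occ | no 1+q≮k with ℕ.≤-antisym q<k (ℕ.≮⇒≥ 1+q≮k)
  ... | refl rewrite stage-block i t q<k | stage-block i (suc t) {0} (s≤s z≤n)
               | stageIn-cut {i} {t} {k′} (ℕ.≤-pred (cut<k t i)) with cut (suc t) i ≤? 0
  ...   | no p  = inj₁ (sym (stageIn-uncut p))
  ...   | yes p with cut-occupied {suc t} {i} (subst (λ c → Occupied i (c + suc t * k)) (sym (ℕ.n≤0⇒n≡0 p)) occ)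
  ...     | _ , full = inj₂ (suc t , full , refl , stageIn-cut p)

  stage-suc : ∀ i j → Occupied i (suc j) → StageStep i j
  stage-suc i j occ = subst (StageStep i) (sym eq)
    (stage-suc-in i (j / k) (j % k) (m%n<n j k) (subst (Occupied i ∘ suc) eq occ))
    where
    eq : j ≡ j % k + j / k * k
    eq = m≡m%n+[m/n]*n j k

  stageᵥ : V → ℕ
  stageᵥ v = stage (row v) (col v)

  opaque
    key : V → ℕ
    key v = (stageᵥ v * R + row v) * C + col v

    key-line : ∀ {u v} → key u ≤ key v → stageᵥ u * R + row u ≤ stageᵥ v * R + row v
    key-line {u} {v} le = [ ℕ.<⇒≤ , ℕ.≤-reflexive ∘ proj₁ ]′ (lex-≤ C (col<C v) le)

    key-stage : ∀ {u v} → key u ≤ key v → stageᵥ u ≤ stageᵥ v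
    key-stage {u} {v} le = [ ℕ.<⇒≤ , ℕ.≤-reflexive ∘ proj₁ ]′ (lex-≤ R (row<R v) (key-line le))

    key-row : ∀ {u v} → key u ≤ key v → stageᵥ v ≤ stageᵥ u → row u ≤ row v
    key-row {u} {v} le sv≤su =
      [ (λ su<sv → contradiction sv≤su (ℕ.<⇒≱ su<sv)) , proj₂ ]′ (lex-≤ R (row<R v) (key-line le))

    key-col : ∀ {u v} → key u ≤ key v → stageᵥ v ≤ stageᵥ u → row v ≤ row u → col u ≤ col v
    key-col {u} {v} le sv≤su rv≤ru = [ (λ lt → contradiction (ℕ.+-mono-≤ (ℕ.*-monoˡ-≤ R sv≤su) rv≤ru) (ℕ.<⇒≱ lt)) , proj₂ ]′
      (lex-≤ C (col<C v) le)

  key-injective : ∀ {u v} → key u ≡ key v → u ≡ v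
  key-injective {u} {v} eq = ι-injective (cong₂ _,_
    (ℕ.≤-antisym (key-row u≤v sv≤su) (key-row v≤u su≤sv))
    (ℕ.≤-antisym (key-col u≤v sv≤su (key-row v≤u su≤sv)) (key-col v≤u su≤sv (key-row u≤v sv≤su))))
    where
    u≤v = ℕ.≤-reflexive eq
    v≤u = ℕ.≤-reflexive (sym eq)
    su≤sv = key-stage {u} {v} u≤v
    sv≤su = key-stage {v} {u} v≤u

  -- If a full row is cut between a placed vertex of stage `t` and a later one of stage `suc t`,
  -- then `t ≤ stageᵥ w ≤ suc t`; hence two lists of full rows.
  specialRows : V → List ℕ
  specialRows w = row w ∷ (fullRows (stageᵥ w) ++ fullRows (stageᵥ w ∸ 1))

  same-stage : ∀ {u w x} → key u ≤ key w → key w < key x → stageᵥ u ≡ stageᵥ x → row u ≡ row x → row u ≡ row w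
  same-stage {u} {w} {x} u≤w w<x su≡sx ru≡rx = ℕ.≤-antisym
    (key-row u≤w (ℕ.≤-trans (key-stage {w} {x} (ℕ.<⇒≤ w<x)) (ℕ.≤-reflexive (sym su≡sx))))
    (ℕ.≤-trans (key-row {w} {x} (ℕ.<⇒≤ w<x) (ℕ.≤-trans (ℕ.≤-reflexive (sym su≡sx)) (key-stage {u} {w} u≤w)))
      (ℕ.≤-reflexive (sym ru≡rx)))

  -- If (row u , col u) and (row u , col x) lie on different sides of w in the order, then
  -- either their row is the one being built or it is cut between them for want of a gap.
  special : ∀ {u w x} → key u ≤ key w → key w < key x → Near (col u) (col x) → row u ≡ row x →
    row u ∈ₗ specialRows w
  special {u} {w} {x} u≤w w<x (inj₁ cx≡1+cu) ru≡rx
    with stage-suc (row u) (col u) (x , cong₂ _,_ (sym ru≡rx) cx≡1+cu)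
  ... | inj₁ same = here (same-stage u≤w w<x (trans same (cong₂ stage ru≡rx (sym cx≡1+cu))) ru≡rx)
  ... | inj₂ (t , full , su≡t , s≡1+t) with ℕ.m≤n⇒m<n∨m≡n (subst (_≤ stageᵥ w) su≡t (key-stage {u} {w} u≤w))
  ...   | inj₂ refl = there (∈-++⁺ˡ (full⁺ (stageᵥ w) (row u) full))
  ...   | inj₁ t<sw = there (∈-++⁺ʳ (fullRows (stageᵥ w)) (full⁺ (stageᵥ w ∸ 1) (row u) (λ {q} → subst (λ s → Full (s ∸ 1) (row u)) 1+t≡sw full {q})))
    where
    sx≡1+t : stageᵥ x ≡ suc t
    sx≡1+t = trans (cong₂ stage (sym ru≡rx) cx≡1+cu) s≡1+t

    1+t≡sw : suc t ≡ stageᵥ w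
    1+t≡sw = ℕ.≤-antisym t<sw (subst (stageᵥ w ≤_) sx≡1+t (key-stage {w} {x} (ℕ.<⇒≤ w<x)))
  special {u} {w} {x} u≤w w<x (inj₂ cu≡1+cx) ru≡rx
    with stage-suc (row x) (col x) (u , cong₂ _,_ ru≡rx cu≡1+cx)
  ... | inj₁ same = here (same-stage u≤w w<x (trans (cong₂ stage ru≡rx cu≡1+cx) (sym same)) ru≡rx)
  ... | inj₂ (t , _ , sx≡t , s≡1+t) = contradiction
    (ℕ.≤-trans (key-stage {u} {w} u≤w) (key-stage {w} {x} (ℕ.<⇒≤ w<x)))
    (ℕ.<⇒≱ (ℕ.≤-reflexive (trans (cong suc sx≡t) (trans (sym s≡1+t) (cong₂ stage (sym ru≡rx) (sym cu≡1+cx))))))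

  -- The first column of block `stageᵥ w ∸ 1`. A stage exceeds its block number by at most one, so
  -- every vertex after `w` lies in this column or further right.
  base : V → ℕ
  base w = (stageᵥ w ∸ 1) * k

  -- The shift by 2 separates column base w − 1, which may still have neighbours to come,
  -- from the earlier ones, which get 0 by truncation.
  offset : V → V → ℕ
  offset w u = (2 + col u) ∸ base w

  offset-≤ : ∀ {u w} → key u ≤ key w → offset w u ≤ suc (2 * k)
  offset-≤ {u} {w} u≤w = ℕ.m≤n+o⇒m∸n≤o (2 + col u) (base w) (begin
    2 + col u                         ≡⟨ cong (2 +_) (m≡m%n+[m/n]*n (col u) k) ⟩
    2 + (col u % k + col u / k * k)   ≤⟨ s≤s (ℕ.+-monoˡ-≤ (col u / k * k) (m%n<n (col u) k)) ⟩
    suc (suc (col u / k) * k)         ≤⟨ s≤s (ℕ.*-monoˡ-≤ k (s≤s (ℕ.≤-trans (stage-≥ (row u) (col u)) (key-stage {u} {w} u≤w)))) ⟩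
    suc (suc (stageᵥ w) * k)          ≤⟨ s≤s (ℕ.*-monoˡ-≤ k (s≤s (ℕ.m≤n+m∸n (stageᵥ w) 1))) ⟩
    suc ((2 + (stageᵥ w ∸ 1)) * k)    ≡⟨ cong suc (cong (_* k) (ℕ.+-comm 2 (stageᵥ w ∸ 1))) ⟩
    suc ((stageᵥ w ∸ 1 + 2) * k)      ≡⟨ cong suc (ℕ.*-distribʳ-+ k (stageᵥ w ∸ 1) 2) ⟩
    suc (base w + 2 * k)              ≡⟨ ℕ.+-suc (base w) (2 * k) ⟨
    base w + suc (2 * k)              ∎)
    where open ℕ.≤-Reasoning

  base-≤ : ∀ {w x} → key w < key x → base w ≤ col x
  base-≤ {w} {x} w<x = begin
    (stageᵥ w ∸ 1) * k     ≤⟨ ℕ.*-monoˡ-≤ k (ℕ.∸-monoˡ-≤ 1 (ℕ.≤-trans (key-stage {w} {x} (ℕ.<⇒≤ w<x)) (stage-≤ (row x) (col x)))) ⟩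
    col x / k * k          ≤⟨ ℕ.m≤n+m _ (col x % k) ⟩
    col x % k + col x / k * k ≡⟨ m≡m%n+[m/n]*n (col x) k ⟨
    col x                  ∎
    where open ℕ.≤-Reasoning

  near-≤ : ∀ {a b} → Near a b → b ≤ suc a
  near-≤ (inj₁ refl) = ℕ.≤-refl
  near-≤ (inj₂ refl) = ℕ.m≤n⇒m≤1+n (ℕ.n≤1+n _)

  -- The later vertex `x` forces `base w ≤ suc (col u)`, so the offset of `u` is positive; the equal
  -- offset of `v` is then not truncated either, and the subtraction cancels.
  offset-col : ∀ {u v w x} → key w < key x → Near (col u) (col x) → offset w u ≡ offset w v → col u ≡ col v
  offset-col {u} {v} {w} {x} w<x near eq = ℕ.suc-injective (ℕ.suc-injective
    (ℕ.∸-cancelʳ-≡ (ℕ.<⇒≤ base<u) (ℕ.<⇒≤ (ℕ.m∸n≢0⇒n<m (λ v≡0 → ℕ.<⇒≢ (ℕ.m<n⇒0<n∸m base<u) (sym (trans eq v≡0))))) eq))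
    where
    base<u : base w < 2 + col u
    base<u = s≤s (ℕ.≤-trans (base-≤ {w} {x} w<x) (near-≤ near))

  module _ (n : ℕ) (few : ∀ t → length (fullRows t) ≤ n) where

    specialRows-length : ∀ w → length (specialRows w) ≤ suc (n + n)
    specialRows-length w = s≤s (ℕ.≤-trans (ℕ.≤-reflexive (length-++ (fullRows (stageᵥ w))))
      (ℕ.+-mono-≤ (few (stageᵥ w)) (few (stageᵥ w ∸ 1))))

    rowCode : V → V → Fin (2 + (n + n))
    rowCode w u = fromℕ< (s≤s (ℕ.≤-trans (slot-≤ (specialRows w) (row u)) (specialRows-length w)))

    colCode : V → V → Fin (2 + 2 * k)
    colCode w u = fromℕ< (s≤s (ℕ.m⊓n≤n (offset w u) (suc (2 * k))))

    colCode-offset : ∀ {u v w} → key u ≤ key w → key v ≤ key w → colCode w u ≡ colCode w v → offset w u ≡ offset w v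
    colCode-offset {u} {v} {w} u≤w v≤w eq = trans (sym (ℕ.m≤n⇒m⊓n≡m (offset-≤ {u} {w} u≤w)))
      (trans (Fin.fromℕ<-injective _ _ _ _ eq) (ℕ.m≤n⇒m⊓n≡m (offset-≤ {v} {w} v≤w)))

    code : V → V → Fin ((2 + (n + n)) * (2 + 2 * k))
    code w u = combine (rowCode w u) (colCode w u)

    -- Equal row codes in one column mean the same vertex or two rows outside `specialRows w`; in
    -- the latter case `x` lies in neither row, and the pair of columns alone decides.
    twins-near : ∀ {u v w x} → key u ≤ key w → key v ≤ key w → key w < key x →
      rowCode w u ≡ rowCode w v → col u ≡ col v → Near (col u) (col x) → adj (graph G) u x ≡ adj (graph G) v x
    twins-near {u} {v} {w} {x} u≤w v≤w w<x rows≡ cols≡ near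
      with slot-≡ (specialRows w) {row u} {row v} (Fin.fromℕ<-injective _ _ _ _ rows≡)
    ... | inj₁ ru≡rv = cong (λ t → adj (graph G) t x) (ι-injective (cong₂ _,_ ru≡rv cols≡))
    ... | inj₂ (u∉ , v∉) = trans (preserves u x) (trans
      (trans (value (row u) (row x)) (trans (cong (proj₁ (adj-near α near) xor_) same) (sym (value (row v) (row x)))))
      (trans (cong (λ b → adj (𝒫^ α) (row v , b) (ι x)) cols≡) (sym (preserves v x))))
      where
      value = proj₂ (adj-near α near)

      same : does (row u ≟ row x) ≡ does (row v ≟ row x)
      same = trans
        (dec-false (row u ≟ row x) λ eq → u∉ (special u≤w w<x near eq))
        (sym (dec-false (row v ≟ row x) λ eq → v∉ (special v≤w w<x (subst (λ b → Near b (col x)) cols≡ near) eq)))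

    code-twins : ∀ w {u v x} → key u ≤ key w → key v ≤ key w → key w < key x →
      code w u ≡ code w v → adj (graph G) u x ≡ adj (graph G) v x
    code-twins w {u} {v} {x} u≤w v≤w w<x eq = cases (near? (col u) (col x)) (near? (col v) (col x))
      where
      codes≡ : rowCode w u ≡ rowCode w v × colCode w u ≡ colCode w v
      codes≡ = Fin.combine-injective (rowCode w u) (colCode w u) (rowCode w v) (colCode w v) eq

      offsets≡ : offset w u ≡ offset w v
      offsets≡ = colCode-offset {u} {v} {w} u≤w v≤w (proj₂ codes≡)

      cases : Dec (Near (col u) (col x)) → Dec (Near (col v) (col x)) → adj (graph G) u x ≡ adj (graph G) v x
      cases (yes near) _ =
        twins-near u≤w v≤w w<x (proj₁ codes≡) (offset-col {u} {v} {w} {x} w<x near offsets≡) near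
      cases (no _) (yes near) = sym
        (twins-near v≤w u≤w w<x (sym (proj₁ codes≡)) (offset-col {v} {u} {w} {x} w<x near (sym offsets≡)) near)
      cases (no far) (no far′) = trans (preserves u x) (trans (adj-far α far (row u) (row x))
        (sym (trans (preserves v x) (adj-far α far′ (row v) (row x)))))

    expression : let c = (2 + (n + n)) * (2 + 2 * k) in
      Σ[ e ∈ Expr (suc c + c) ] (Linear e × graph G ≅ ⟦ e ⟧)
    expression = LinearConstruction.linear-expression (graph G) key key-injective code code-twins

  module _ (block-periodic : ∀ t j → α (j + t * k) ≡ α j) (H : FinGraph) (H∈𝒢 : 𝒢 α H) where

    open _≤ᵢ_ H∈𝒢 renaming (injection to injectionᴴ; preserves to preservesᴴ)
    open Injection injectionᴴ using () renaming (to to κ; injective to κ-injective)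

    towards-shift : ∀ t {i j i′ j′ r r′} → does (r ≟ r′) ≡ does (i ≟ i′) →
      towards α (i , j) (i′ , j′) ≡ towards α (r , j + t * k) (r′ , j′ + t * k)
    towards-shift t {j = j} {j′ = j′} eq = cong₂ _∧_
      (does-⇔ (mk⇔ (cong (_+ t * k)) (ℕ.+-cancelʳ-≡ (t * k) j′ (suc j))) (j′ ≟ suc j) (j′ + t * k ≟ suc j + t * k))
      (cong₂ _xor_ (sym (block-periodic t j)) (sym eq))

    -- Rows of `H` go to distinct full rows of block `t`, and columns move by `t * k`, a shift that
    -- preserves the letters of `α`.
    embed : ∀ {n} → (∀ v → proj₁ (κ v) < n) → (∀ v → proj₂ (κ v) < k) → ∀ t → n ≤ length (fullRows t) →
      graph H ≤ᵢ graph G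
    embed rows<n cols<k t n≤len = record { injection = mk↣ f-injective ; preserves = f-preserves }
      where
      r : Fin (suc (order-1 H)) → ℕ
      r v = lookup (fullRows t) (inject≤ (fromℕ< (rows<n v)) n≤len)

      r-injective : ∀ {u v} → r u ≡ r v → proj₁ (κ u) ≡ proj₁ (κ v)
      r-injective {u} {v} eq = Fin.fromℕ<-injective _ _ _ _ (Fin.inject≤-injective n≤len n≤len _ _
        (lookup-injective (fullRows-unique t) eq))

      r-cong : ∀ {u v} → proj₁ (κ u) ≡ proj₁ (κ v) → r u ≡ r v
      r-cong eq = cong (λ i → lookup (fullRows t) (inject≤ i n≤len)) (Fin.fromℕ<-cong _ _ eq _ _)

      r-full : ∀ v → Full t (r v)
      r-full v = full⁻ t (r v) (∈-lookup _)

      f : Fin (suc (order-1 H)) → V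
      f v = proj₁ (r-full v (cols<k v))

      ι-f : ∀ v → ι (f v) ≡ (r v , proj₂ (κ v) + t * k)
      ι-f v = proj₂ (r-full v (cols<k v))

      f-injective : ∀ {u v} → f u ≡ f v → u ≡ v
      f-injective {u} {v} eq = κ-injective (cong₂ _,_ (r-injective {u} {v} (Product.,-injectiveˡ places≡))
        (ℕ.+-cancelʳ-≡ (t * k) _ _ (Product.,-injectiveʳ places≡)))
        where
        places≡ = trans (sym (ι-f u)) (trans (cong ι eq) (ι-f v))

      rows-does : ∀ u v → does (r u ≟ r v) ≡ does (proj₁ (κ u) ≟ proj₁ (κ v))
      rows-does u v = does-⇔ (mk⇔ (r-injective {u} {v}) (r-cong {u} {v})) (r u ≟ r v) (proj₁ (κ u) ≟ proj₁ (κ v))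

      shift : ∀ u v → towards α (κ u) (κ v) ≡ towards α (r u , proj₂ (κ u) + t * k) (r v , proj₂ (κ v) + t * k)
      shift u v = towards-shift t {proj₁ (κ u)} {proj₂ (κ u)} {proj₁ (κ v)} {proj₂ (κ v)} {r u} {r v} (rows-does u v)

      f-preserves : ∀ u v → adj (graph H) u v ≡ adj (graph G) (f u) (f v)
      f-preserves u v = trans (preservesᴴ u v) (trans
        (cong₂ _∨_ (shift u v) (shift v u))
        (trans (sym (cong₂ (adj (𝒫^ α)) (ι-f u) (ι-f v))) (sym (preserves (f u) (f v)))))

-- Bounded width of proper subclasses, and minimality

module _ {α : Word} (H : FinGraph) (H∈𝒢 : 𝒢 α H) where

  free-bounded : Periodic α → ∃[ k ] (∀ G → 𝒢 α G → ¬ (graph H ≤ᵢ graph G) →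
    Σ[ e ∈ Expr k ] (Linear e × graph G ≅ ⟦ e ⟧))
  -- The block length `suc (p + b * suc p)` is `suc b * suc p`: a multiple of the period, and wide
  -- enough for the columns of `H`. The label count does not depend on `G`.
  free-bounded (suc p , _ , per) = _ , λ G G∈𝒢 H≰G → let open Blocks α (p + b * suc p) G G∈𝒢 in
    expression n λ t → ℕ.<⇒≤ (ℕ.≰⇒> λ n≤len → H≰G (embed block-periodic H H∈𝒢 rows<n cols<k t n≤len))
    where
    κ = Injection.to (_≤ᵢ_.injection H∈𝒢)

    n b : ℕ
    n = proj₁ (fin-bounded (proj₁ ∘ κ))
    b = proj₁ (fin-bounded (proj₂ ∘ κ))

    rows<n : ∀ v → proj₁ (κ v) < n
    rows<n = proj₂ (fin-bounded (proj₁ ∘ κ))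

    cols<k : ∀ v → proj₂ (κ v) < suc b * suc p
    cols<k v = ℕ.<-≤-trans (proj₂ (fin-bounded (proj₂ ∘ κ)) v) (ℕ.≤-trans (ℕ.n≤1+n b) (ℕ.m≤m*n (suc b) (suc p)))

    block-periodic : ∀ t j → α (j + t * (suc b * suc p)) ≡ α j
    block-periodic t j = trans (cong (λ l → α (j + l)) (sym (ℕ.*-assoc t (suc b) (suc p)))) (periodic-* α per (t * suc b) j)

-- Shows that some number of labels suffices, so that there is something to minimise. Every vertex
-- is its own code.
trivial-expression : ∀ {n} (G : Graph (Fin (suc n))) →
  let c = suc n in Σ[ e ∈ Expr (suc c + c) ] (Linear e × G ≅ ⟦ e ⟧)
trivial-expression G = LinearConstruction.linear-expression G toℕ Fin.toℕ-injective
  (λ _ v → v) (λ _ _ _ _ eq → cong (λ v → adj G v _) eq)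

module _ {α : Word} (periodic : Periodic α) (one : ∃[ i ] (α i ≡ true)) where

  -- Both widths at once: upper bounds come from linear expressions, the lower bound holds against
  -- all expressions, and the two hypotheses put `Expressible` in between.
  minimal-𝒢 : ∀ {ℓ} (Expressible : FinGraph → Pred ℕ 0ℓ) →
    (∀ {G k} (e : Expr k) → Linear e → graph G ≅ ⟦ e ⟧ → Expressible G k) →
    (∀ {G k} → Expressible G k → Σ[ e ∈ Expr k ] (graph G ≅ ⟦ e ⟧)) →
    MinimalHereditaryUnbounded ℓ (IsMinimum ∘ Expressible) (𝒢 α)
  minimal-𝒢 Expressible linear⇒ ⇒expr = record
    { hereditary = λ G∈𝒢 H≤G → ≤ᵢ-trans H≤G G∈𝒢
    ; unbounded  = λ (k , bound) →
        let _ , 0<p , per = periodic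
            G , G∈𝒢 , none = large-grid 0<p per (proj₂ one) k
            e , lin , iso = trivial-expression (graph G)
        in ¬¬-minimum {Expressible G} (linear⇒ e lin iso) λ (w , min) →
             let e′ , iso′ = ⇒expr (proj₁ min) in none (bound G∈𝒢 min) e′ iso′
    ; minimal    = λ Y hereditary-Y (Y⊆𝒢 , H , H∈𝒢 , H∉Y) →
        let k , express = free-bounded H H∈𝒢 periodic
        in k , λ {G} G∈Y (_ , least) →
          let e , lin , iso = express G (Y⊆𝒢 G∈Y) (λ H≤G → H∉Y (hereditary-Y G∈Y H≤G))
          in least (linear⇒ e lin iso) }

theorem1 : (ℓ : Level) (α : Word) → Periodic α → (∃[ i ] (α i ≡ true)) →
    MinimalHereditaryUnbounded ℓ IsCliqueWidth (𝒢 α) ×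
    MinimalHereditaryUnbounded ℓ IsLinearCliqueWidth (𝒢 α)
theorem1 ℓ α periodic one =
  minimal-𝒢 periodic one (λ G k → Σ[ e ∈ Expr k ] (graph G ≅ ⟦ e ⟧)) (λ e _ iso → e , iso) id ,
  minimal-𝒢 periodic one (λ G k → Σ[ e ∈ Expr k ] (Linear e × graph G ≅ ⟦ e ⟧))
    (λ e lin iso → e , lin , iso) (λ (e , _ , iso) → e , iso)
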